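{- Let $m,n\ge 3$ be integers with $mn\equiv 2 \pmod 4$. Then $\chi_3(G_{m,n})=5$.
   Context: For positive integers $m,n$, the grid $G_{m,n}$ is the graph with vertex set $[m]\times[n]$ (where $[p]=\{1,\dots,p\}$) in which $(i,j)$ and $(i',j')$ are adjacent if and only if $|i-i'|+|j-j'|=1$. For a graph $G$ and integers $r,k\ge1$, an $r$-dynamic $k$-coloring of $G$ is a proper vertex coloring $f$ of $G$ with at most $k$ colors such that $|f(N(v))|\ge\min\{r,d(v)\}$ for every vertex $v$, where $N(v)$ is the neighborhood of $v$, $d(v)$ its degree, and $f(U)=\{f(u): u\in U\}$. The $r$-dynamic chromatic number $\chi_r(G)$ is the least $k$ such that $G$ has an $r$-dynamic $k$-coloring. -}

module Defs where

open import Data.Nat using (ℕ; _+_; _⊓_; ∣_-_∣; _≡ᵇ_)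
open import Data.Bool using (Bool; true)
open import Data.Fin using (Fin; toℕ)
open import Data.Fin.Properties using (_≟_)
open import Data.Product using (_×_; _,_; Σ)
open import Data.List using (List; filter; map; length; deduplicate; cartesianProduct; allFin)
open import Data.List.Membership.Propositional using (_∈_)
open import Data.List.Relation.Unary.Unique.Propositional using (Unique)
open import Relation.Binary.PropositionalEquality using (_≡_; _≢_)
open import Data.Bool using (T)
open import Data.Nat using (_≥_; _≤_)
open import Data.List.Membership.Propositional.Properties using (∈-cartesianProduct⁺; ∈-allFin)
open import Data.List.Relation.Unary.Unique.Propositional.Properties using (cartesianProduct⁺; allFin⁺)

record FinGraph : Set₁ where
  field
    V        : Set
    vertices : List V
    complete : ∀ v → v ∈ vertices
    unique   : Unique vertices
    adj      : V → V → Bool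

open FinGraph public

N : (G : FinGraph) → V G → List (V G)
N G v = filter (λ u → T? (adj G v u)) (vertices G)
  where
  open import Data.Bool.Properties using (T?)

deg : (G : FinGraph) → V G → ℕ
deg G v = length (N G v)

colourCount : (G : FinGraph) {k : ℕ} → (V G → Fin k) → V G → ℕ
colourCount G f v = length (deduplicate _≟_ (map f (N G v)))

IsProper : (G : FinGraph) {k : ℕ} → (V G → Fin k) → Set
IsProper G f = ∀ u v → T (adj G u v) → f u ≢ f v

IsDynamicColouring : (G : FinGraph) (r k : ℕ) → (V G → Fin k) → Set
IsDynamicColouring G r k f =
  IsProper G f × (∀ v → colourCount G f v ≥ (r ⊓ deg G v))

HasDynamicColouring : (G : FinGraph) (r k : ℕ) → Set
HasDynamicColouring G r k = Σ (V G → Fin k) (IsDynamicColouring G r k)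

DynamicChromaticNumberIs : (G : FinGraph) (r c : ℕ) → Set
DynamicChromaticNumberIs G r c =
  HasDynamicColouring G r c × (∀ k → HasDynamicColouring G r k → c ≤ k)

gridAdj : (m n : ℕ) → Fin m × Fin n → Fin m × Fin n → Bool
gridAdj m n (i , j) (i' , j') = (∣ toℕ i - toℕ i' ∣ + ∣ toℕ j - toℕ j' ∣) ≡ᵇ 1

grid : (m n : ℕ) → FinGraph
grid m n = record
  { V        = Fin m × Fin n
  ; vertices = cartesianProduct (allFin m) (allFin n)
  ; complete = λ { (i , j) → ∈-cartesianProduct⁺ (∈-allFin i) (∈-allFin j) }
  ; unique   = cartesianProduct⁺ (allFin⁺ m) (allFin⁺ n)
  ; adj      = gridAdj m n
  }

{-# OPTIONS --safe #-}
module Submission where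

-- The colouring (i , j) ↦ i + 2 j mod 5 gives distinct colours to all neighbours of every vertex.
--
-- For the lower bound, suppose there are at most four colours. Each interior vertex v sees three
-- colours, so exactly two of its neighbours n, s, w, e agree. If w = e, or n = e and ne = s, or
-- n = w and nw = s, then the vertex just north of v also has w = e, or one of the latter two
-- patterns occurs at the vertex just west (respectively east) of v. Sideways moves
-- keep their direction, and no pattern can sit on the left, right or top side, where all three
-- neighbours differ; as the moves cannot go on forever, no pattern occurs at all. With the same statement in
-- the other three directions, the two equal neighbours of v span an alternating 2 × 2 block with v
-- as a corner. These blocks tile the interior, so both side lengths are even, which contradicts
-- mn ≡ 2 (mod 4). Only the tiling of the first interior column is needed.

open import Defs
open import Data.Nat using (ℕ; _≥_; _*_; _%_)
open import Relation.Binary.PropositionalEquality using (_≡_)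

open import Data.Bool using (T)
open import Data.Bool.Properties using (T?)
open import Data.Fin using (Fin; toℕ; fromℕ<)
open import Data.Fin.Properties using (_≟_; toℕ-fromℕ<; toℕ-injective; toℕ<n)
open import Data.List using (List; []; _∷_; map; length; filter; deduplicate; allFin)
open import Data.List.Membership.Propositional using (_∈_)
open import Data.List.Membership.Propositional.Properties using (∈-filter⁺; ∈-filter⁻; ∈-allFin; ∈-map⁻; ∈-map⁺; ∈-deduplicate⁻; ∈-deduplicate⁺)
open import Data.List.Properties using (filter-notAll; length-tabulate; length-map)
open import Data.List.Relation.Unary.All as All using (All; []; _∷_)
open import Data.List.Relation.Unary.AllPairs using ([]; _∷_)
open import Data.List.Relation.Unary.Any as Any using (here; there)
open import Data.List.Relation.Unary.Unique.Propositional using (Unique)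
import Data.List.Relation.Unary.All.Properties as All
import Data.List.Relation.Unary.Unique.Propositional.Properties as Unique
open import Data.List.Relation.Unary.Unique.DecPropositional.Properties using (deduplicate-!)
open import Data.Nat using (zero; suc; _+_; _∸_; _≤_; _<_; z≤n; s≤s; ∣_-_∣)
open import Data.Nat.DivMod using (m%n<n; %-distribˡ-+; [m+kn]%n≡m%n; m<n⇒m%n≡m; m*n%n≡0)
open import Data.Nat.Properties hiding (_≟_)
open import Data.Nat.Solver using (module +-*-Solver)
open +-*-Solver using (solve; _:=_; _:+_; _:*_; con)
open import Data.Product using (_×_; _,_; proj₁; proj₂; ∃)
open import Data.Product.Properties using (≡-dec)
open import Data.Sum using (_⊎_; inj₁; inj₂)
open import Relation.Binary.Definitions using (DecidableEquality)
open import Relation.Binary.PropositionalEquality using (_≢_; refl; sym; trans; cong; cong₂; subst; ≢-sym; module ≡-Reasoning)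
open import Relation.Nullary using (¬_; yes; no; contradiction)
open import Relation.Nullary.Decidable using (¬?)

-- Counting distinct entries of lists.

unique-⊆⇒length-≤ : ∀ {A : Set} → DecidableEquality A → ∀ {xs ys : List A} →
  Unique xs → (∀ {x} → x ∈ xs → x ∈ ys) → length xs ≤ length ys
unique-⊆⇒length-≤ _≟ᴬ_ [] sub = z≤n
unique-⊆⇒length-≤ _≟ᴬ_ {x ∷ xs} {ys} (x∉xs ∷ !xs) sub =
  -- Deleting `x` from `ys` makes it strictly shorter, yet keeps every entry of the tail `xs`.
  ≤-trans (s≤s (unique-⊆⇒length-≤ _≟ᴬ_ !xs sub′))
          (filter-notAll x≢? ys (Any.map (λ x≡y x≢y → x≢y x≡y) (sub (here refl))))
  where
  x≢? = λ y → ¬? (x ≟ᴬ y)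
  sub′ : ∀ {y} → y ∈ xs → y ∈ filter x≢? ys
  sub′ y∈xs = ∈-filter⁺ x≢? (sub (there y∈xs)) (All.lookup x∉xs y∈xs)

Distinct : {A : Set} → A → A → A → Set
Distinct a b c = a ≢ b × a ≢ c × b ≢ c

-- At least three colours occur. Phrased as the failure of any two values to cover the list, this is
-- insensitive to order and repetition.
Spread : {A : Set} → List A → Set
Spread xs = ∀ p q → ¬ All (_∈ p ∷ q ∷ []) xs

pattern 1st e = here e
pattern 2nd e = there (here e)
pattern 3rd e = there (there (here e))

-- Were two of `a`, `b`, `c` equal, two values would already cover `xs`.
spread⇒distinct : ∀ {A : Set} {xs : List A} {a b c} →
  Spread xs → All (_∈ a ∷ b ∷ c ∷ []) xs → Distinct a b c
spread⇒distinct {a = a} {b} {c} sp all =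
    (λ { refl → sp a c (All.map (λ { (1st e) → 1st e ; (2nd e) → 1st e ; (3rd e) → 2nd e }) all) })
  , (λ { refl → sp a b (All.map (λ { (1st e) → 1st e ; (2nd e) → 2nd e ; (3rd e) → 1st e }) all) })
  , (λ { refl → sp a b (All.map (λ { (1st e) → 1st e ; (2nd e) → 2nd e ; (3rd e) → 2nd e }) all) })

-- Colourings of a rectangle and their symmetries.

-- An abstract colouring of the rectangle [0 .. M + 1] × [0 .. N + 1]; values outside it are junk.
record Dynamic (M N : ℕ) {A : Set} (g : ℕ → ℕ → A) : Set where
  field
    vert   : ∀ {i j} → i ≤ M → j ≤ suc N → g i j ≢ g (suc i) j
    horz   : ∀ {i j} → i ≤ suc M → j ≤ N → g i j ≢ g i (suc j)
    inner  : ∀ {i j} → i < M → j < N →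
             Spread (g i (1 + j) ∷ g (2 + i) (1 + j) ∷ g (1 + i) j ∷ g (1 + i) (2 + j) ∷ [])
    top    : ∀ {j} → j < N → Distinct (g 0 j) (g 0 (2 + j)) (g 1 (1 + j))
    bottom : ∀ {j} → j < N → Distinct (g (1 + M) j) (g (1 + M) (2 + j)) (g M (1 + j))
    left   : ∀ {i} → i < M → Distinct (g i 0) (g (2 + i) 0) (g (1 + i) 1)
    right  : ∀ {i} → i < M → Distinct (g i (1 + N)) (g (2 + i) (1 + N)) (g (1 + i) N)

transposed : {A : Set} → (ℕ → ℕ → A) → ℕ → ℕ → A
transposed g i j = g j i

flipped : {A : Set} → ℕ → (ℕ → ℕ → A) → ℕ → ℕ → A
flipped M g i j = g (suc M ∸ i) j

swap-distinct : ∀ {A : Set} {a b c : A} → Distinct a b c → Distinct b a c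
swap-distinct (ab , ac , bc) = ≢-sym ab , bc , ac

transpose : ∀ {M N} {A : Set} {g : ℕ → ℕ → A} → Dynamic M N g → Dynamic N M (transposed g)
transpose D = record
  { vert   = λ i≤ j≤ → horz j≤ i≤
  ; horz   = λ i≤ j≤ → vert j≤ i≤
  ; inner  = λ { i< j< p q (n ∷ s ∷ w ∷ e ∷ []) → inner j< i< p q (w ∷ e ∷ n ∷ s ∷ []) }
  ; top    = left
  ; bottom = right
  ; left   = top
  ; right  = bottom
  }
  where open Dynamic D

1+M∸i : ∀ {i M} → i ≤ M → suc M ∸ i ≡ suc (M ∸ i)
1+M∸i = +-∸-assoc 1

M∸i : ∀ {i M} → i < M → M ∸ i ≡ suc (M ∸ suc i)
M∸i {i} {suc M} (s≤s i≤M) = 1+M∸i i≤M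

2+M∸i : ∀ {i M} → i < M → suc M ∸ i ≡ 2 + (M ∸ suc i)
2+M∸i i<M = trans (1+M∸i (<⇒≤ i<M)) (cong suc (M∸i i<M))

∸-suc-< : ∀ {i M} → i < M → M ∸ suc i < M
∸-suc-< {i} {suc M} _ = s≤s (m∸n≤m M i)

flip : ∀ {M N} {A : Set} {g : ℕ → ℕ → A} → Dynamic M N g → Dynamic M N (flipped M g)
flip {M} {N} {g = g} D = record
  { vert   = vert′
  ; horz   = λ {i} _ j≤ → horz (m∸n≤m (suc M) i) j≤
  ; inner  = inner′
  ; top    = bottom
  ; bottom = bottom′
  ; left   = left′
  ; right  = right′
  }
  where
  open Dynamic D
  vert′ : ∀ {i j} → i ≤ M → j ≤ suc N → g (suc M ∸ i) j ≢ g (M ∸ i) j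
  vert′ {i} i≤ j≤ rewrite 1+M∸i i≤ = ≢-sym (vert (m∸n≤m M i) j≤)
  inner′ : ∀ {i j} → i < M → j < N →
    Spread (g (suc M ∸ i) (1 + j) ∷ g (M ∸ suc i) (1 + j) ∷ g (M ∸ i) j ∷ g (M ∸ i) (2 + j) ∷ [])
  inner′ i< j< p q (n ∷ s ∷ w ∷ e ∷ []) rewrite 2+M∸i i< | M∸i i< =
    inner (∸-suc-< i<) j< p q (s ∷ n ∷ w ∷ e ∷ [])
  bottom′ : ∀ {j} → j < N →
    Distinct (g (M ∸ M) j) (g (M ∸ M) (2 + j)) (g (suc M ∸ M) (1 + j))
  bottom′ j< rewrite 1+M∸i {M} ≤-refl | n∸n≡0 M = top j<
  left′ : ∀ {i} → i < M → Distinct (g (suc M ∸ i) 0) (g (M ∸ suc i) 0) (g (M ∸ i) 1)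
  left′ i< rewrite 2+M∸i i< | M∸i i< = swap-distinct (left (∸-suc-< i<))
  right′ : ∀ {i} → i < M →
    Distinct (g (suc M ∸ i) (1 + N)) (g (M ∸ suc i) (1 + N)) (g (M ∸ i) N)
  right′ i< rewrite 2+M∸i i< | M∸i i< = swap-distinct (right (∸-suc-< i<))

-- Local structure with at most four colours.

module FourColours {k : ℕ} (k<5 : k < 5) where

  -- Three colours leave room for only one more: otherwise `e`, `d`, `a`, `b`, `c` would be five
  -- different elements of `Fin k`.
  fourth : ∀ {a b c d e : Fin k} → Distinct a b c → d ≢ a → d ≢ b → d ≢ c →
    e ≢ a → e ≢ b → e ≢ c → e ≡ d
  fourth {a} {b} {c} {d} {e} (ab , ac , bc) da db dc ea eb ec with e ≟ d
  ... | yes e≡d = e≡d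
  ... | no  e≢d = contradiction 5≤k (<⇒≱ k<5)
    where
    5≤k : 5 ≤ k
    5≤k = subst (5 ≤_) (length-tabulate {n = k} (λ i → i)) (unique-⊆⇒length-≤ _≟_
      {e ∷ d ∷ a ∷ b ∷ c ∷ []} {allFin k}
      ((e≢d ∷ ea ∷ eb ∷ ec ∷ []) ∷ (da ∷ db ∷ dc ∷ []) ∷ (ab ∷ ac ∷ []) ∷ (bc ∷ []) ∷ [] ∷ [])
      (λ {x} _ → ∈-allFin x))

  -- The 3 × 3 window with north-west corner `(i , j)`, so that its centre `v` is an interior
  -- vertex. Row indices grow southwards.
  module Window {M N : ℕ} {g : ℕ → ℕ → Fin k} (D : Dynamic M N g)
                {i j : ℕ} (i< : i < M) (j< : j < N) where
    open Dynamic D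
    nw n ne w v e sw s se : Fin k
    nw = g i j
    n  = g i (1 + j)
    ne = g i (2 + j)
    w  = g (1 + i) j
    v  = g (1 + i) (1 + j)
    e  = g (1 + i) (2 + j)
    sw = g (2 + i) j
    s  = g (2 + i) (1 + j)
    se = g (2 + i) (2 + j)

    private
      i≤ : i ≤ suc M
      i≤ = m≤n⇒m≤1+n (<⇒≤ i<)
      j≤ : j ≤ suc N
      j≤ = m≤n⇒m≤1+n (<⇒≤ j<)
      1+i≤ : suc i ≤ suc M
      1+i≤ = m≤n⇒m≤1+n i<
      1+j≤ : suc j ≤ suc N
      1+j≤ = m≤n⇒m≤1+n j<

    v≢n : v ≢ n
    v≢n = ≢-sym (vert (<⇒≤ i<) 1+j≤)
    v≢s : v ≢ s
    v≢s = vert i< 1+j≤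
    v≢w : v ≢ w
    v≢w = ≢-sym (horz 1+i≤ (<⇒≤ j<))
    v≢e : v ≢ e
    v≢e = horz 1+i≤ j<
    nw≢n : nw ≢ n
    nw≢n = horz i≤ (<⇒≤ j<)
    ne≢n : ne ≢ n
    ne≢n = ≢-sym (horz i≤ j<)
    nw≢w : nw ≢ w
    nw≢w = vert (<⇒≤ i<) j≤
    ne≢e : ne ≢ e
    ne≢e = vert (<⇒≤ i<) (s≤s j<)
    sw≢s : sw ≢ s
    sw≢s = horz (s≤s i<) (<⇒≤ j<)
    se≢s : se ≢ s
    se≢s = ≢-sym (horz (s≤s i<) j<)
    sw≢w : sw ≢ w
    sw≢w = ≢-sym (vert i< j≤)
    se≢e : se ≢ e
    se≢e = ≢-sym (vert i< (s≤s j<))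

    -- Four neighbours show at least three colours, so one coincidence among them excludes any
    -- other. The next four facts are alike.
    n≡e⇒distinct : n ≡ e → Distinct n s w
    n≡e⇒distinct q = spread⇒distinct (inner i< j<) (1st refl ∷ 2nd refl ∷ 3rd refl ∷ 1st (sym q) ∷ [])
    n≡w⇒distinct : n ≡ w → Distinct n s e
    n≡w⇒distinct q = spread⇒distinct (inner i< j<) (1st refl ∷ 2nd refl ∷ 1st (sym q) ∷ 3rd refl ∷ [])
    s≡e⇒distinct : s ≡ e → Distinct s n w
    s≡e⇒distinct q = spread⇒distinct (inner i< j<) (2nd refl ∷ 1st refl ∷ 3rd refl ∷ 1st (sym q) ∷ [])
    s≡w⇒distinct : s ≡ w → Distinct s n e
    s≡w⇒distinct q = spread⇒distinct (inner i< j<) (2nd refl ∷ 1st refl ∷ 1st (sym q) ∷ 3rd refl ∷ [])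
    w≡e⇒distinct : w ≡ e → Distinct n s w
    w≡e⇒distinct q = spread⇒distinct (inner i< j<) (1st refl ∷ 2nd refl ∷ 3rd refl ∷ 3rd (sym q) ∷ [])

  -- Excluding repeats and bends by moving up and sideways.

  RowRepeats : (ℕ → ℕ → Fin k) → ℕ → ℕ → Set
  RowRepeats g i j = g i j ≡ g i (2 + j)

  -- Around (i + 1 , j + 1): north = east and north-east = south, respectively
  -- north = west and north-west = south.
  EastBend WestBend : (ℕ → ℕ → Fin k) → ℕ → ℕ → Set
  EastBend g i j = g i (1 + j) ≡ g (1 + i) (2 + j) × g i (2 + j) ≡ g (2 + i) (1 + j)
  WestBend g i j = g i (1 + j) ≡ g (1 + i) j       × g i j       ≡ g (2 + i) (1 + j)

  module Upward {M N : ℕ} {g : ℕ → ℕ → Fin k} (D : Dynamic M N g) where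
    open Dynamic D

    -- If `nw` = `v`, the vertex `w` has equal north and east neighbours, so its south neighbour
    -- `sw` differs from `v`. It also differs from `s` and `w`, hence equals `n`, and `w` carries an
    -- east bend. For `j` = 0 the left side forbids `nw` = `v` directly.
    nw≢v : ∀ {i} j (i< : i < M) (j< : j < N) → (∀ j′ → suc j′ ≡ j → ¬ EastBend g i j′) →
      (let open Window D i< j<) → Distinct n s w → nw ≢ v
    nw≢v zero    i< j< _ _ nw≡v = proj₁ (proj₂ (left i<)) nw≡v
    nw≢v (suc j) i< j< no-bend (n≢s , n≢w , s≢w) nw≡v = no-bend j refl (nw≡v , sym sw≡n)
      where
      open Window D i< j<
      sw≢v : sw ≢ v
      sw≢v sw≡v = proj₁ (Window.n≡e⇒distinct D i< (<-trans (n<1+n j) j<) nw≡v) (trans nw≡v (sym sw≡v))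
      sw≡n : sw ≡ n
      sw≡n = fourth (v≢s , v≢w , s≢w) (≢-sym v≢n) n≢s n≢w sw≢v sw≢s sw≢w

    -- The mirror image of `nw≢v`: a west bend would appear at `e`, unless `e` lies on the right
    -- side.
    ne≢v : ∀ {i j} (i< : i < M) (j< : j < N) → (suc j < N → ¬ WestBend g i (suc j)) →
      (let open Window D i< j<) → Distinct n s e → ne ≢ v
    ne≢v {i} {j} i< j< no-bend (n≢s , n≢e , s≢e) ne≡v with m≤n⇒m<n∨m≡n j<
    ... | inj₂ 1+j≡N = subst (λ t → g i (suc t) ≢ g (suc i) t) (sym 1+j≡N) (proj₁ (proj₂ (right i<))) ne≡v
    ... | inj₁ 1+j<N = no-bend 1+j<N (ne≡v , sym se≡n)
      where
      open Window D i< j<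
      se≢v : se ≢ v
      se≢v se≡v = proj₁ (Window.n≡w⇒distinct D i< 1+j<N ne≡v) (trans ne≡v (sym se≡v))
      se≡n : se ≡ n
      se≡n = fourth (v≢s , v≢e , s≢e) (≢-sym v≢n) n≢s n≢e se≢v se≢s se≢e

    -- The inductive step over rows: a repeat-free row `i` excludes bends centred on row `i + 1` and
    -- then repeats in that row.
    module Row {i} (i< : i < M) (above : ∀ {j} → j < N → ¬ RowRepeats g i j) where

      no-east-bend : ∀ j → j < N → ¬ EastBend g i j
      -- Here `nw` avoids `s` because `ne` = `s` and row `i` has no repeat, so `nw` = `v`. This
      -- pushes the bend one column west, and the recursion on `j` ends at the left side.
      no-east-bend j j< (n≡e , ne≡s) = nw≢v j i< j< (previous j j<) distinct
        (fourth distinct v≢n v≢s v≢w nw≢n (λ nw≡s → above j< (trans nw≡s (sym ne≡s))) nw≢w)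
        where
        open Window D i< j<
        distinct : Distinct n s w
        distinct = n≡e⇒distinct n≡e
        previous : ∀ j → j < N → ∀ j′ → suc j′ ≡ j → ¬ EastBend g i j′
        previous (suc j) j< .j refl = no-east-bend j (<-trans (n<1+n j) j<)

      -- West bends move east, so `j` increases; `t` bounds the number of columns left and makes the
      -- recursion structural.
      no-west-bend : ∀ t j → N ≤ t + j → j < N → ¬ WestBend g i j
      no-west-bend zero    j N≤j j< = contradiction N≤j (<⇒≱ j<)
      no-west-bend (suc t) j N≤  j< (n≡w , nw≡s) =
        ne≢v i< j< (no-west-bend t (suc j) (subst (N ≤_) (sym (+-suc t j)) N≤)) distinct
          (fourth distinct v≢n v≢s v≢e ne≢n (λ ne≡s → above j< (trans nw≡s (sym ne≡s))) ne≢e)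
        where
        open Window D i< j<
        distinct : Distinct n s e
        distinct = n≡w⇒distinct n≡w

      no-west-bend′ : ∀ {j} → j < N → ¬ WestBend g i j
      no-west-bend′ = no-west-bend N _ (m≤m+n N _)

      -- When `w` = `e`, both `nw` and `ne` are coloured like `v` or `s`. They cannot both match
      -- `s`, as row `i` has no repeat, so one matches `v` and forces a bend at `w` or `e`, or
      -- clashes with a side.
      no-row-repeat-below : ∀ {j} → j < N → ¬ RowRepeats g (suc i) j
      no-row-repeat-below {j} j< w≡e with Window.nw D i< j< ≟ Window.v D i< j<
      ... | yes nw≡v = nw≢v j i< j< (λ { j′ refl → no-east-bend j′ (<-trans (n<1+n j′) j<) })
                         (Window.w≡e⇒distinct D i< j< w≡e) nw≡v
      ... | no  nw≢v = ne≢v i< j< (λ 1+j< → no-west-bend′ 1+j<) (n≢s , subst (n ≢_) w≡e n≢w , subst (s ≢_) w≡e s≢w)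
                         (fourth (n≢s , n≢w , s≢w) v≢n v≢s v≢w ne≢n ne≢s (subst (ne ≢_) (sym w≡e) ne≢e))
        where
        open Window D i< j<
        distinct = w≡e⇒distinct w≡e
        n≢s = proj₁ distinct
        n≢w = proj₁ (proj₂ distinct)
        s≢w = proj₂ (proj₂ distinct)
        nw≡s : nw ≡ s
        nw≡s = fourth (v≢n , v≢w , n≢w) (≢-sym v≢s) (≢-sym n≢s) s≢w nw≢v nw≢n nw≢w
        ne≢s : ne ≢ s
        ne≢s ne≡s = above j< (trans nw≡s (sym ne≡s))

    no-row-repeat : ∀ i → i ≤ M → ∀ {j} → j < N → ¬ RowRepeats g i j
    no-row-repeat zero    _  j< = proj₁ (top j<)
    no-row-repeat (suc i) i< j< = Row.no-row-repeat-below i< (no-row-repeat i (<⇒≤ i<)) j<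

    no-east : ∀ {i j} → i < M → j < N → ¬ EastBend g i j
    no-east {i} {j} i< = Row.no-east-bend i< (no-row-repeat i (<⇒≤ i<)) j

    no-west : ∀ {i j} → i < M → j < N → ¬ WestBend g i j
    no-west {i} {j} i< = Row.no-west-bend′ i< (no-row-repeat i (<⇒≤ i<))

  -- Reflection sends this window to the one starting at row `M ∸ suc i`: the centre row is kept,
  -- and the north and south rows are exchanged.
  module Downward {M N : ℕ} {g : ℕ → ℕ → Fin k} (D : Dynamic M N g)
                  {i j : ℕ} (i< : i < M) (j< : j < N) where
    open Window D i< j<

    private
      centre : M ∸ (M ∸ suc i) ≡ suc i
      centre = m∸[m∸n]≡n i<
      north : suc M ∸ (M ∸ suc i) ≡ 2 + i
      north = trans (1+M∸i (m∸n≤m M (suc i))) (cong suc centre)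
      south : M ∸ suc (M ∸ suc i) ≡ i
      south = trans (cong (M ∸_) (sym (M∸i i<))) (m∸[m∸n]≡n (<⇒≤ i<))

    no-east : ¬ (s ≡ e × se ≡ n)
    no-east bend = Upward.no-east (flip D) (∸-suc-< i<) j< flipped-bend
      where
      flipped-bend : EastBend (flipped M g) (M ∸ suc i) j
      flipped-bend rewrite centre | north | south = bend

    no-west : ¬ (s ≡ w × sw ≡ n)
    no-west bend = Upward.no-west (flip D) (∸-suc-< i<) j< flipped-bend
      where
      flipped-bend : WestBend (flipped M g) (M ∸ suc i) j
      flipped-bend rewrite centre | north | south = bend

  -- Alternating 2 × 2 blocks.

  module Block {M N : ℕ} {g : ℕ → ℕ → Fin k} (D : Dynamic M N g)
               {i j : ℕ} (i< : i < M) (j< : j < N) where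
    open Window D i< j<
    private Dᵀ = transpose D

    n≢s : n ≢ s
    n≢s = Upward.no-row-repeat Dᵀ (suc j) j< i<
    w≢e : w ≢ e
    w≢e = Upward.no-row-repeat D (suc i) i< j<

    -- The corner `ne` is adjacent to the equal pair, and the bends of the grid and of its transpose
    -- keep it from the other two neighbour colours; only the colour of `v` remains. The other three
    -- corners follow by symmetry.
    n≡e⇒ne≡v : n ≡ e → ne ≡ v
    n≡e⇒ne≡v n≡e = fourth (n≡e⇒distinct n≡e) v≢n v≢s v≢w ne≢n
      (λ ne≡s → Upward.no-east D i< j< (n≡e , ne≡s))
      (λ ne≡w → Downward.no-west Dᵀ j< i< (sym n≡e , ne≡w))

    n≡w⇒nw≡v : n ≡ w → nw ≡ v
    n≡w⇒nw≡v n≡w = fourth (n≡w⇒distinct n≡w) v≢n v≢s v≢e nw≢n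
      (λ nw≡s → Upward.no-west D i< j< (n≡w , nw≡s))
      (λ nw≡e → Upward.no-west Dᵀ j< i< (sym n≡w , nw≡e))

    s≡e⇒se≡v : s ≡ e → se ≡ v
    s≡e⇒se≡v s≡e = fourth (s≡e⇒distinct s≡e) v≢s v≢n v≢w se≢s
      (λ se≡n → Downward.no-east D i< j< (s≡e , se≡n))
      (λ se≡w → Downward.no-east Dᵀ j< i< (sym s≡e , se≡w))

    s≡w⇒sw≡v : s ≡ w → sw ≡ v
    s≡w⇒sw≡v s≡w = fourth (s≡w⇒distinct s≡w) v≢s v≢n v≢e sw≢s
      (λ sw≡n → Downward.no-west D i< j< (s≡w , sw≡n))
      (λ sw≡e → Upward.no-east Dᵀ j< i< (sym s≡w , sw≡e))

  -- Tiling the first interior column.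

  module FirstColumn {M N : ℕ} {g : ℕ → ℕ → Fin k} (D : Dynamic M N g) (0<N : 0 < N) where
    open Dynamic D

    -- A block using `w` would give `v` the colour of a corner on the left side, against `left`.
    -- Opposite neighbours differ, so `e` must pair with `n` or `s`, or else it would share the
    -- colour of `v`.
    n≢e⇒s≡e : ∀ {i} (i< : i < M) → (let open Window D i< 0<N) → n ≢ e → s ≡ e
    n≢e⇒s≡e i< n≢e with Window.s D i< 0<N ≟ Window.e D i< 0<N
    ... | yes s≡e = s≡e
    ... | no  s≢e = contradiction (sym e≡v) v≢e
      where
      open Window D i< 0<N
      open Block D i< 0<N
      n≢w : n ≢ w
      n≢w n≡w = proj₁ (proj₂ (left i<)) (n≡w⇒nw≡v n≡w)
      s≢w : s ≢ w
      s≢w s≡w = proj₂ (proj₂ (left i<)) (s≡w⇒sw≡v s≡w)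
      e≡v : e ≡ v
      e≡v = fourth (n≢s , n≢w , s≢w) v≢n v≢s v≢w (≢-sym n≢e) (≢-sym s≢e) (≢-sym w≢e)

    -- Every second vertex, starting next to the top side, begins a block reaching south. At the
    -- top, a block reaching north contradicts `top`. Further down, the previous block makes the
    -- vertex in between have `n` = `e`, hence `n` different from `s`, which a block reaching north
    -- would violate.
    block-below : ∀ t (t< : t * 2 < M) → (let open Window D t< 0<N) → s ≡ e
    block-below zero    0<M = n≢e⇒s≡e 0<M λ n≡e →
      proj₂ (proj₂ (top 0<N)) (Block.n≡e⇒ne≡v D 0<M 0<N n≡e)
    block-below (suc t) 2+i< = n≢e⇒s≡e 2+i< λ n≡e →
      proj₁ (Window.n≡e⇒distinct D 1+i< 0<N (sym se≡v))
            (trans (sym se≡v) (Block.n≡e⇒ne≡v D 2+i< 0<N n≡e))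
      where
      1+i< : suc (t * 2) < M
      1+i< = <-trans (n<1+n _) 2+i<
      i< : t * 2 < M
      i< = <-trans (n<1+n _) 1+i<
      se≡v : Window.se D i< 0<N ≡ Window.v D i< 0<N
      se≡v = Block.s≡e⇒se≡v D i< 0<N (block-below t i<)

  -- With an odd number of interior rows the last one begins a block reaching south, whose `se` and
  -- `v` are kept apart by `bottom`.
  odd⇒¬dynamic : ∀ t {N} {g : ℕ → ℕ → Fin k} → 0 < N → ¬ Dynamic (suc (t * 2)) N g
  odd⇒¬dynamic t 0<N D = proj₂ (proj₂ (Dynamic.bottom D 0<N))
    (Block.s≡e⇒se≡v D (n<1+n _) 0<N (FirstColumn.block-below D 0<N t (n<1+n _)))

-- From grid colourings to abstract colourings.

-- Matching on the direction enumerates neighbours and discards those beyond the top and left sides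
-- by unification.
data Adjacent : ℕ → ℕ → ℕ → ℕ → Set where
  north : ∀ {i j} → Adjacent (suc i) j i j
  south : ∀ {i j} → Adjacent i j (suc i) j
  west  : ∀ {i j} → Adjacent i (suc j) i j
  east  : ∀ {i j} → Adjacent i j i (suc j)

∣suc-∣ : ∀ n → ∣ suc n - n ∣ ≡ 1
∣suc-∣ zero    = refl
∣suc-∣ (suc n) = ∣suc-∣ n

∣-∣≡1 : ∀ m n → ∣ m - n ∣ ≡ 1 → m ≡ suc n ⊎ n ≡ suc m
∣-∣≡1 zero    n       refl = inj₂ refl
∣-∣≡1 (suc m) zero    refl = inj₁ refl
∣-∣≡1 (suc m) (suc n) eq with ∣-∣≡1 m n eq
... | inj₁ refl = inj₁ refl
... | inj₂ refl = inj₂ refl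

adjacent⇒ : ∀ {i j x y} → Adjacent i j x y → ∣ i - x ∣ + ∣ j - y ∣ ≡ 1
adjacent⇒ {j = j} (north {i}) rewrite ∣suc-∣ i | ∣n-n∣≡0 j = refl
adjacent⇒ {j = j} (south {i}) rewrite ∣-∣-comm i (suc i) | ∣suc-∣ i | ∣n-n∣≡0 j = refl
adjacent⇒ {i} (west {j = j}) rewrite ∣suc-∣ j | ∣n-n∣≡0 i = refl
adjacent⇒ {i} (east {j = j}) rewrite ∣-∣-comm j (suc j) | ∣suc-∣ j | ∣n-n∣≡0 i = refl

⇒adjacent : ∀ i j x y → ∣ i - x ∣ + ∣ j - y ∣ ≡ 1 → Adjacent i j x y
⇒adjacent i j x y eq with ∣ i - x ∣ in p | ∣ j - y ∣ in q
⇒adjacent i j x y refl | zero | _ with refl ← ∣m-n∣≡0⇒m≡n {i} {x} p | ∣-∣≡1 j y q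
... | inj₁ refl = west
... | inj₂ refl = east
⇒adjacent i j x y eq | suc zero | zero with refl ← ∣m-n∣≡0⇒m≡n {j} {y} q | ∣-∣≡1 i x p
... | inj₁ refl = north
... | inj₂ refl = south

gridAdj⇒adjacent : ∀ {m n} (u v : Fin m × Fin n) → T (gridAdj m n u v) →
  Adjacent (toℕ (proj₁ u)) (toℕ (proj₂ u)) (toℕ (proj₁ v)) (toℕ (proj₂ v))
gridAdj⇒adjacent u v t = ⇒adjacent _ _ _ _ (≡ᵇ⇒≡ _ 1 t)

∈-N⁻ : ∀ (G : FinGraph) v {u} → u ∈ N G v → T (adj G v u)
∈-N⁻ G v u∈ = proj₂ (∈-filter⁻ (λ u → T? (adj G v u)) {xs = vertices G} u∈)

∈-N⁺ : ∀ (G : FinGraph) v {u} → T (adj G v u) → u ∈ N G v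
∈-N⁺ G v {u} t = ∈-filter⁺ (λ u → T? (adj G v u)) (complete G u) t

-- Extends a colouring of the grid to all of ℕ × ℕ by sending outside indices to the last row or
-- column.
clamp : ∀ m → ℕ → Fin (suc m)
clamp m i = fromℕ< (s≤s (m⊓n≤n i m))

toℕ-clamp : ∀ {m i} → i ≤ m → toℕ (clamp m i) ≡ i
toℕ-clamp {m} {i} i≤m = trans (toℕ-fromℕ< (s≤s (m⊓n≤n i m))) (m≤n⇒m⊓n≡m i≤m)

clamp-toℕ : ∀ {m} (i : Fin (suc m)) → clamp m (toℕ i) ≡ i
clamp-toℕ i = toℕ-injective (toℕ-clamp (≤-pred (toℕ<n i)))

module FromGrid {m n k : ℕ} {f : Fin (suc m) × Fin (suc n) → Fin k}
                (dyn : IsDynamicColouring (grid (suc m) (suc n)) 3 k f) where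
  G : FinGraph
  G = grid (suc m) (suc n)

  g : ℕ → ℕ → Fin k
  g i j = f (clamp m i , clamp n j)

  position : V G → ℕ × ℕ
  position (a , b) = toℕ a , toℕ b

  InGrid : ℕ → ℕ → Set
  InGrid i j = i ≤ m × j ≤ n

  Neighbour : ℕ → ℕ → ℕ × ℕ → Set
  Neighbour i j (x , y) = InGrid x y × Adjacent i j x y

  adj-clamp : ∀ {i j x y} → InGrid i j → Neighbour i j (x , y) →
    T (adj G (clamp m i , clamp n j) (clamp m x , clamp n y))
  adj-clamp (i≤ , j≤) ((x≤ , y≤) , a)
    rewrite toℕ-clamp i≤ | toℕ-clamp j≤ | toℕ-clamp x≤ | toℕ-clamp y≤ = ≡⇒≡ᵇ _ 1 (adjacent⇒ a)

  edge : ∀ {i j x y} → InGrid i j → InGrid x y → Adjacent i j x y → g i j ≢ g x y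
  edge ij xy a = proj₁ dyn _ _ (adj-clamp ij (xy , a))

  length≤deg : ∀ {i j us} → InGrid i j → Unique us → All (Neighbour i j) us →
    length us ≤ deg G (clamp m i , clamp n j)
  length≤deg {i} {j} {us} ij !us nbrs = subst (length us ≤_) (length-map position (N G v))
    (unique-⊆⇒length-≤ (≡-dec Data.Nat._≟_ Data.Nat._≟_) !us sub)
    where
    v : V G
    v = clamp m i , clamp n j
    sub : ∀ {u} → u ∈ us → u ∈ map position (N G v)
    sub {x , y} u∈ with nbr@((x≤ , y≤) , _) ← All.lookup nbrs u∈ =
      subst (_∈ _) (cong₂ _,_ (toℕ-clamp x≤) (toℕ-clamp y≤))
        (∈-map⁺ position (∈-N⁺ G v (adj-clamp ij nbr)))

  -- Three different neighbours raise `3 ⊓ deg` to 3, whereas neighbour colours confined to `p` and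
  -- `q` allow a count of at most 2.
  spread : ∀ {i j a b c} → InGrid i j → Unique (a ∷ b ∷ c ∷ []) →
    All (Neighbour i j) (a ∷ b ∷ c ∷ []) → ∀ xs →
    (∀ {x y} → InGrid x y → Adjacent i j x y → g x y ∈ xs) → Spread xs
  spread {i} {j} ij@(i≤ , j≤) !us nbrs xs cover p q all = <⇒≱ (s≤s colours≤2) colours≥3
    where
    v : V G
    v = clamp m i , clamp n j
    colours≥3 : 3 ≤ colourCount G f v
    colours≥3 = ≤-trans (⊓-glb ≤-refl (length≤deg ij !us nbrs)) (proj₂ dyn v)
    colour∈ : ∀ {u} → T (adj G v u) → f u ∈ p ∷ q ∷ []
    colour∈ {u@(a , b)} t = subst (λ u → f u ∈ p ∷ q ∷ []) (cong₂ _,_ (clamp-toℕ a) (clamp-toℕ b))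
      (All.lookup all (cover (≤-pred (toℕ<n a) , ≤-pred (toℕ<n b)) adjacent))
      where
      adjacent : Adjacent i j (toℕ a) (toℕ b)
      adjacent = subst (λ x → Adjacent x j (toℕ a) (toℕ b)) (toℕ-clamp i≤)
        (subst (λ y → Adjacent _ y (toℕ a) (toℕ b)) (toℕ-clamp j≤) (gridAdj⇒adjacent v u t))
    colours≤2 : colourCount G f v ≤ 2
    colours≤2 = unique-⊆⇒length-≤ _≟_ (deduplicate-! _≟_ (map f (N G v))) sub
      where
      sub : ∀ {c} → c ∈ deduplicate _≟_ (map f (N G v)) → c ∈ p ∷ q ∷ []
      sub c∈ with u , u∈ , refl ← ∈-map⁻ f (∈-deduplicate⁻ _≟_ (map f (N G v)) c∈) = colour∈ {u} (∈-N⁻ G v u∈)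

  three-distinct : ∀ {i j x₁ y₁ x₂ y₂ x₃ y₃} → InGrid i j →
    Unique ((x₁ , y₁) ∷ (x₂ , y₂) ∷ (x₃ , y₃) ∷ []) →
    All (Neighbour i j) ((x₁ , y₁) ∷ (x₂ , y₂) ∷ (x₃ , y₃) ∷ []) →
    (∀ {x y} → InGrid x y → Adjacent i j x y → g x y ∈ g x₁ y₁ ∷ g x₂ y₂ ∷ g x₃ y₃ ∷ []) →
    Distinct (g x₁ y₁) (g x₂ y₂) (g x₃ y₃)
  three-distinct ij !us nbrs cover =
    spread⇒distinct (spread ij !us nbrs _ cover) (1st refl ∷ 2nd refl ∷ 3rd refl ∷ [])

dynamic : ∀ {M N k} {f : Fin (2 + M) × Fin (2 + N) → Fin k}
  (dyn : IsDynamicColouring (grid (2 + M) (2 + N)) 3 k f) → Dynamic M N (FromGrid.g dyn)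
dynamic {M} {N} dyn = record
  { vert   = λ i≤ j≤ → edge (m≤n⇒m≤1+n i≤ , j≤) (s≤s i≤ , j≤) south
  ; horz   = λ i≤ j≤ → edge (i≤ , m≤n⇒m≤1+n j≤) (i≤ , s≤s j≤) east
  ; inner  = λ i< j< → spread (s≤s (<⇒≤ i<) , s≤s (<⇒≤ j<))
      (((λ ()) ∷ (λ ()) ∷ []) ∷ ((λ ()) ∷ []) ∷ [] ∷ [])
      (((lo i< , s≤s (<⇒≤ j<)) , north) ∷ ((s≤s i< , s≤s (<⇒≤ j<)) , south) ∷ ((s≤s (<⇒≤ i<) , lo j<) , west) ∷ [])
      _ λ { _ north → here refl ; _ south → there (here refl)
          ; _ west → there (there (here refl)) ; _ east → there (there (there (here refl))) }
  ; top    = λ j< → three-distinct (z≤n , s≤s (<⇒≤ j<))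
      (((λ ()) ∷ (λ ()) ∷ []) ∷ ((λ ()) ∷ []) ∷ [] ∷ [])
      (((z≤n , lo j<) , west) ∷ ((z≤n , s≤s j<) , east) ∷ ((s≤s z≤n , s≤s (<⇒≤ j<)) , south) ∷ [])
      λ { _ west → 1st refl ; _ east → 2nd refl ; _ south → 3rd refl }
  ; bottom = λ j< → three-distinct (≤-refl , s≤s (<⇒≤ j<))
      (((λ ()) ∷ (λ ()) ∷ []) ∷ ((λ ()) ∷ []) ∷ [] ∷ [])
      (((≤-refl , lo j<) , west) ∷ ((≤-refl , s≤s j<) , east) ∷ ((n≤1+n M , s≤s (<⇒≤ j<)) , north) ∷ [])
      λ { _ west → 1st refl ; _ east → 2nd refl ; _ north → 3rd refl
        -- Row `2 + M` lies outside the grid; this direction is excluded by the bound, not by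
        -- unification.
        ; (2+M≤ , _) south → contradiction 2+M≤ 1+n≰n }
  ; left   = λ i< → three-distinct (s≤s (<⇒≤ i<) , z≤n)
      (((λ ()) ∷ (λ ()) ∷ []) ∷ ((λ ()) ∷ []) ∷ [] ∷ [])
      (((lo i< , z≤n) , north) ∷ ((s≤s i< , z≤n) , south) ∷ ((s≤s (<⇒≤ i<) , s≤s z≤n) , east) ∷ [])
      λ { _ north → 1st refl ; _ south → 2nd refl ; _ east → 3rd refl }
  ; right  = λ i< → three-distinct (s≤s (<⇒≤ i<) , ≤-refl)
      (((λ ()) ∷ (λ ()) ∷ []) ∷ ((λ ()) ∷ []) ∷ [] ∷ [])
      (((lo i< , ≤-refl) , north) ∷ ((s≤s i< , ≤-refl) , south) ∷ ((s≤s (<⇒≤ i<) , n≤1+n N) , west) ∷ [])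
      λ { _ north → 1st refl ; _ south → 2nd refl ; _ west → 3rd refl
        ; (_ , 2+N≤) east → contradiction 2+N≤ 1+n≰n }
  }
  where
  open FromGrid dyn
  lo : ∀ {i M} → i < M → i ≤ suc M
  lo i<M = m≤n⇒m≤1+n (<⇒≤ i<M)

-- The lower bound by parity.

parity : ∀ n → ∃ λ t → n ≡ t * 2 ⊎ n ≡ suc (t * 2)
parity zero    = 0 , inj₁ refl
parity (suc n) with parity n
... | t , inj₁ refl = t , inj₂ refl
... | t , inj₂ refl = suc t , inj₁ refl

-- `M` and `N` count interior rows and columns. An odd one is impossible, directly or after
-- transposing; if both are even, 4 divides the number of vertices.
lower-bound : ∀ {M N k} → 0 < M → 0 < N → ((2 + M) * (2 + N)) % 4 ≡ 2 →
  HasDynamicColouring (grid (2 + M) (2 + N)) 3 k → 5 ≤ k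
lower-bound {M} {N} {k} 0<M 0<N mn%4≡2 (f , dyn) = ≮⇒≥ impossible
  where
  impossible : ¬ k < 5
  impossible k<5 with parity M | parity N
  ... | s , inj₂ refl | _             = FourColours.odd⇒¬dynamic k<5 s 0<N (dynamic dyn)
  ... | _             | t , inj₂ refl = FourColours.odd⇒¬dynamic k<5 t 0<M (transpose (dynamic dyn))
  ... | s , inj₁ refl | t , inj₁ refl = contradiction (trans (sym mn%4≡2) mn%4≡0) λ ()
    where
    mn%4≡0 : ((2 + s * 2) * (2 + t * 2)) % 4 ≡ 0
    mn%4≡0 = trans (cong (_% 4) (solve 2 (λ s t →
        (con 2 :+ s :* con 2) :* (con 2 :+ t :* con 2) := ((con 1 :+ s) :* (con 1 :+ t)) :* con 4) refl s t))
      (m*n%n≡0 ((1 + s) * (1 + t)) 4)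

-- The diagonal colouring with five colours.

unique-map : ∀ {A B : Set} (f : A → B) {xs} → Unique xs →
  (∀ {x y} → x ∈ xs → y ∈ xs → f x ≡ f y → x ≡ y) → Unique (map f xs)
unique-map f [] inj = []
unique-map f (x∉ ∷ !xs) inj =
  All.map⁺ (All.tabulate λ y∈ fx≡fy → All.lookup x∉ y∈ (inj (here refl) (there y∈) fx≡fy))
  ∷ unique-map f !xs λ x∈ y∈ → inj (there x∈) (there y∈)

-- Each vertex then sees as many colours as it has neighbours, which meets the bound for every `r`.
neighbourhood-injective⇒dynamic : ∀ (G : FinGraph) {k} r (f : V G → Fin k) → IsProper G f →
  (∀ v {x y} → T (adj G v x) → T (adj G v y) → f x ≡ f y → x ≡ y) → IsDynamicColouring G r k f
neighbourhood-injective⇒dynamic G r f proper inj = proper , λ v →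
  ≤-trans (m⊓n≤n r (deg G v)) (subst (_≤ colourCount G f v) (length-map f (N G v))
    (unique-⊆⇒length-≤ _≟_
      (unique-map f (Unique.filter⁺ (λ u → T? (adj G v u)) (unique G)) λ x∈ y∈ → inj v (∈-N⁻ G v x∈) (∈-N⁻ G v y∈))
      (∈-deduplicate⁺ _≟_)))

value : ℕ → ℕ → ℕ
value i j = i + 2 * j

-- The change of `value` along an edge, one of -2, -1, 1, 2, shifted by 2 to stay in ℕ. The vertex
-- itself would have offset 2.
offset : ∀ {i j x y} → Adjacent i j x y → ℕ
offset west  = 0
offset north = 1
offset south = 3
offset east  = 4

offset<5 : ∀ {i j x y} (a : Adjacent i j x y) → offset a < 5
offset<5 west  = s≤s z≤n
offset<5 north = s≤s (s≤s z≤n)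
offset<5 south = s≤s (s≤s (s≤s (s≤s z≤n)))
offset<5 east  = ≤-refl

offset≢2 : ∀ {i j x y} (a : Adjacent i j x y) → 2 ≢ offset a
offset≢2 west  ()
offset≢2 north ()
offset≢2 south ()
offset≢2 east  ()

offset-injective : ∀ {i j x y x′ y′} (a : Adjacent i j x y) (b : Adjacent i j x′ y′) →
  offset a ≡ offset b → x ≡ x′ × y ≡ y′
offset-injective west  west  _ = refl , refl
offset-injective north north _ = refl , refl
offset-injective south south _ = refl , refl
offset-injective east  east  _ = refl , refl

value-offset : ∀ {i j x y} (a : Adjacent i j x y) → value x y + 2 ≡ offset a + value i j
value-offset {i} {_} {_} {y} west = solve 2 (λ i j → (i :+ con 2 :* j) :+ con 2 := i :+ con 2 :* (con 1 :+ j)) refl i y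
value-offset {_} {j} {x} north = solve 2 (λ i j → (i :+ con 2 :* j) :+ con 2 := con 1 :+ ((con 1 :+ i) :+ con 2 :* j)) refl x j
value-offset {i} {j} south = solve 2 (λ i j → ((con 1 :+ i) :+ con 2 :* j) :+ con 2 := con 3 :+ (i :+ con 2 :* j)) refl i j
value-offset {i} {j} east = solve 2 (λ i j → (i :+ con 2 :* (con 1 :+ j)) :+ con 2 := con 4 :+ (i :+ con 2 :* j)) refl i j

%5-+ : ∀ c {a b} → a % 5 ≡ b % 5 → (a + c) % 5 ≡ (b + c) % 5
%5-+ c {a} {b} eq = begin
  (a + c) % 5             ≡⟨ %-distribˡ-+ a c 5 ⟩
  (a % 5 + c % 5) % 5     ≡⟨ cong (λ t → (t + c % 5) % 5) eq ⟩
  (b % 5 + c % 5) % 5     ≡⟨ %-distribˡ-+ b c 5 ⟨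
  (b + c) % 5             ∎
  where open ≡-Reasoning

-- Adding 4 c turns c into the multiple 5 c of the modulus.
%5-cancel : ∀ c {a b} → a < 5 → b < 5 → (a + c) % 5 ≡ (b + c) % 5 → a ≡ b
%5-cancel c {a} {b} a<5 b<5 eq = begin
  a                        ≡⟨ reduce a a<5 ⟨
  (a + c + 4 * c) % 5      ≡⟨ %5-+ (4 * c) {a + c} {b + c} eq ⟩
  (b + c + 4 * c) % 5      ≡⟨ reduce b b<5 ⟩
  b                        ∎
  where
  open ≡-Reasoning
  reduce : ∀ a → a < 5 → (a + c + 4 * c) % 5 ≡ a
  reduce a a<5 = begin
    (a + c + 4 * c) % 5    ≡⟨ cong (_% 5) (solve 2 (λ a c → (a :+ c) :+ con 4 :* c := a :+ c :* con 5) refl a c) ⟩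
    (a + c * 5) % 5        ≡⟨ [m+kn]%n≡m%n a c 5 ⟩
    a % 5                  ≡⟨ m<n⇒m%n≡m a<5 ⟩
    a                      ∎

-- Offsets are residues modulo 5, so congruent values around a common `s` come from the same offset.
offsets-agree : ∀ s {a b x y} → a < 5 → b < 5 → x + 2 ≡ a + s → y + 2 ≡ b + s → x % 5 ≡ y % 5 → a ≡ b
offsets-agree s {a} {b} {x} {y} a<5 b<5 p q eq = %5-cancel s a<5 b<5 (begin
  (a + s) % 5    ≡⟨ cong (_% 5) p ⟨
  (x + 2) % 5    ≡⟨ %5-+ 2 {x} {y} eq ⟩
  (y + 2) % 5    ≡⟨ cong (_% 5) q ⟩
  (b + s) % 5    ∎)
  where open ≡-Reasoning

valueAt : ∀ {m n} → Fin m × Fin n → ℕ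
valueAt (a , b) = value (toℕ a) (toℕ b)

diagonal : ∀ {m n} → Fin m × Fin n → Fin 5
diagonal u = fromℕ< (m%n<n (valueAt u) 5)

diagonal≡⇒ : ∀ {m n} (u v : Fin m × Fin n) → diagonal u ≡ diagonal v →
  valueAt u % 5 ≡ valueAt v % 5
diagonal≡⇒ u v eq = trans (sym (toℕ-fromℕ< (m%n<n (valueAt u) 5))) (trans (cong toℕ eq) (toℕ-fromℕ< (m%n<n (valueAt v) 5)))

diagonal-dynamic : ∀ m n r → IsDynamicColouring (grid m n) r 5 diagonal
diagonal-dynamic m n r = neighbourhood-injective⇒dynamic (grid m n) r diagonal proper injective
  where
  proper : IsProper (grid m n) diagonal
  -- The vertex `u` is compared with its neighbour by giving it the offset 2, which no edge has.
  proper u v t eq = offset≢2 a (offsets-agree (valueAt u) (s≤s (s≤s (s≤s z≤n))) (offset<5 a)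
    (+-comm (valueAt u) 2) (value-offset a) (diagonal≡⇒ u v eq))
    where a = gridAdj⇒adjacent u v t
  injective : ∀ v {x y} → T (gridAdj m n v x) → T (gridAdj m n v y) → diagonal x ≡ diagonal y → x ≡ y
  injective v {x} {y} s t eq =
    let a = gridAdj⇒adjacent v x s
        b = gridAdj⇒adjacent v y t
        p , q = offset-injective a b (offsets-agree (valueAt v) (offset<5 a) (offset<5 b)
                  (value-offset a) (value-offset b) (diagonal≡⇒ x y eq))
    in cong₂ _,_ (toℕ-injective p) (toℕ-injective q)

theorem1p5 : (m n : ℕ) → m ≥ 3 → n ≥ 3 → (m * n) % 4 ≡ 2 →
    DynamicChromaticNumberIs (grid m n) 3 5
theorem1p5 (suc (suc m)) (suc (suc n)) (s≤s (s≤s 0<m)) (s≤s (s≤s 0<n)) mn%4≡2 =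
  (diagonal , diagonal-dynamic (2 + m) (2 + n) 3) , λ k → lower-bound 0<m 0<n mn%4≡2
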